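{- Let $G$ be a simple connected undirected graph with vertices $v_1,\dots,v_n$, $n\ge 2$, and Laplacian matrix $L$. Let $\gamma_1\ge\cdots\ge\gamma_{n-1}\ge\gamma_n=0$ be the eigenvalues of $L$, and let $S_i=(s_{i1},\dots,s_{in})^T$, $1\le i\le n$, be real, normalized, mutually orthogonal eigenvectors of $L$, with $S_i$ corresponding to $\gamma_i$. Then $G$ is resistance regular if and only if the quantity $$\frac{1}{\deg_G(v_i)}\left(\sum_{v_j\in N(v_i)}\left(\sum_{k=1}^{n-1}\frac{1}{\gamma_k}s_{ki}s_{kj}\right)+1-\frac1n\right)$$ is the same for every $i\in\{1,2,\dots,n\}$.
   Context: $\deg_G(v_i)$ is the degree of $v_i$ and $N(v_i)$ is the set of neighbors of $v_i$. The Laplacian matrix is $L=D-A$, where $A$ is the adjacency matrix and $D$ the diagonal matrix of vertex degrees. With $L^\dagger=(l^\dagger_{ij})$ the Moore-Penrose inverse of $L$, the resistance distance between $v_i$ and $v_j$ is $r_{ij}=l^\dagger_{ii}+l^\dagger_{jj}-2l^\dagger_{ij}$. The resistance distance matrix is $R(G)=(r_{ij})_{n\times n}$, and $R_i=\sum_{j=1}^n r_{ij}$ is the resistance degree of $v_i$. $G$ is resistance regular if all $R_i$ are equal. -}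

module Defs where

open import Level using (0ℓ; _⊔_) renaming (suc to lsuc)
open import Algebra.Apartness.Bundles using (HeytingField)
import Algebra.Apartness.Properties.HeytingCommutativeRing as HCRProperties
open import Algebra.Bundles using (CommutativeRing; Semiring)
import Algebra.Definitions.RawSemiring as SemiringDefinitions
import Algebra.Properties.Ring as RingProperties
import Algebra.Properties.Semiring.Sum as SemiringSum
open import Data.Bool.Base using (if_then_else_)
open import Data.Empty using (⊥-elim)
open import Data.Fin.Base as Fin using (Fin; zero; suc; fromℕ)
open import Data.Fin.Properties using () renaming (_≟_ to _≟ᶠ_)
open import Data.List.Base as List using (List; allFin; filter; length)
open import Data.List.Membership.Propositional using (_∈_)
open import Data.List.Membership.Propositional.Properties using (∈-filter⁺; ∈-allFin)
open import Data.List.Relation.Unary.Any using (here; there)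
open import Data.Nat.Base as ℕ using (ℕ; zero; suc; z≤n; s≤s)
open import Data.Product.Base using (∃-syntax; _×_; _,_; proj₁; proj₂)
open import Data.Sum.Base using (_⊎_; inj₁; inj₂)
open import Data.Vec.Functional using (Vector)
open import Relation.Binary.Core using (Rel)
open import Relation.Binary.Definitions using (Symmetric; Irreflexive; Decidable)
open import Relation.Binary.Structures using (IsStrictPartialOrder)
open import Relation.Binary.Construct.Closure.ReflexiveTransitive using (Star; ε; _◅_)
open import Relation.Binary.PropositionalEquality.Core using (_≡_; _≢_; refl)
open import Relation.Nullary.Decidable.Core using (⌊_⌋)
open import Relation.Nullary.Negation.Core using (¬_)

-- The real numbers, axiomatised constructively as a Cauchy-complete
-- Archimedean ordered field.  Classically these axioms determine ℝ up to
-- unique isomorphism; constructively they hold of both the Cauchy and the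
-- Dedekind reals (x # y is then "x < y or y < x").  The ∃ in the completeness
-- axiom is a Σ-type, so a Cauchy sequence comes with its modulus.
record RealField c ℓ₁ ℓ₂ ℓ₃ : Set (lsuc (c ⊔ ℓ₁ ⊔ ℓ₂ ⊔ ℓ₃)) where
  infix 4 _<_ _≤_
  field
    heytingField : HeytingField c ℓ₁ ℓ₂

  open HeytingField heytingField public hiding (refl; sym; trans)
  open HeytingField heytingField public using ()
    renaming (refl to ≈-refl; sym to ≈-sym; trans to ≈-trans)

  commutativeRing : CommutativeRing c ℓ₁
  commutativeRing =
    record { isCommutativeRing = HeytingField.isCommutativeRing heytingField }

  open CommutativeRing commutativeRing public using (semiring)
  -- n · x is the n-fold sum x + ⋯ + x; in particular n · 1# is n as a real.
  open SemiringDefinitions (Semiring.rawSemiring semiring) public using () renaming (_×_ to _·_)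

  field
    _<_                  : Rel Carrier ℓ₃
    isStrictPartialOrder : IsStrictPartialOrder _≈_ _<_
    #⇒<⊎>                : ∀ {x y} → x # y → x < y ⊎ y < x
    <⇒#                  : ∀ {x y} → x < y → x # y
    +-monoˡ-<            : ∀ {x y} z → x < y → x + z < y + z
    *-pos                : ∀ {x y} → 0# < x → 0# < y → 0# < x * y
    archimedean          : ∀ x → ∃[ n ] x < n · 1#

  -- ∣ x - y ∣ < δ
  Within : Carrier → Carrier → Carrier → Set ℓ₃
  Within δ x y = (x - y < δ) × (y - x < δ)

  Cauchy : (ℕ → Carrier) → Set (c ⊔ ℓ₃)
  Cauchy a = ∀ δ → 0# < δ →
    ∃[ N ] (∀ p q → N ℕ.≤ p → N ℕ.≤ q → Within δ (a p) (a q))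

  ConvergesTo : (ℕ → Carrier) → Carrier → Set (c ⊔ ℓ₃)
  ConvergesTo a l = ∀ δ → 0# < δ → ∃[ N ] (∀ p → N ℕ.≤ p → Within δ (a p) l)

  field
    complete : ∀ a → Cauchy a → ∃[ l ] ConvergesTo a l

  _≤_ : Rel Carrier ℓ₃
  x ≤ y = ¬ (y < x)

  -- #⇒invertible inverts x - 0#, which is only ≈ to x.
  1/_[_] : ∀ x → x # 0# → Carrier
  1/ x [ x#0 ] = proj₁ (#⇒invertible x#0)

  private
    module O = IsStrictPartialOrder isStrictPartialOrder
    module R = RingProperties (CommutativeRing.ring commutativeRing)

    0<1 : 0# < 1#
    0<1 with #⇒<⊎> (HCRProperties.1#0 (HeytingField.heytingCommutativeRing heytingField))
    ... | inj₂ 0<1′ = 0<1′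
    ... | inj₁ 1<0 = O.<-respʳ-≈ -1*-1≈1 (*-pos 0<-1 0<-1)
      where
      0<-1 : 0# < - 1#
      0<-1 = O.<-respˡ-≈ (-‿inverseʳ 1#)
               (O.<-respʳ-≈ (+-identityˡ (- 1#)) (+-monoˡ-< (- 1#) 1<0))
      -1*-1≈1 : - 1# * - 1# ≈ 1#
      -1*-1≈1 = ≈-trans (R.-1*x≈-x (- 1#)) (R.-‿involutive 1#)

    0<1+n : ∀ n → 0# < suc n · 1#
    0<1+n zero    = O.<-respʳ-≈ (≈-sym (+-identityʳ 1#)) 0<1
    0<1+n (suc n) = O.trans (0<1+n n)
      (O.<-respˡ-≈ (+-identityˡ _) (+-monoˡ-< (suc n · 1#) 0<1))

  ℕ#0 : ∀ n → 0 ℕ.< n → n · 1# # 0#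
  ℕ#0 (suc n) _ = #-sym (<⇒# (0<1+n n))

record Graph (n : ℕ) : Set₁ where
  infix 4 _~_ _~?_
  field
    _~_      : Rel (Fin n) 0ℓ
    _~?_     : Decidable _~_
    ~-sym    : Symmetric _~_
    ~-irrefl : Irreflexive _≡_ _~_

  N : Fin n → List (Fin n)
  N i = filter (i ~?_) (allFin n)

  deg : Fin n → ℕ
  deg i = length (N i)

  Connected : Set
  Connected = ∀ i j → Star _~_ i j

open Graph public using (N; deg; Connected)

connected⇒0<deg : ∀ {n} → 2 ℕ.≤ n → (G : Graph n) → Connected G → ∀ i → 0 ℕ.< deg G i
connected⇒0<deg (s≤s (s≤s z≤n)) G conn i = start (other i)
  where
  open Graph G using (_~_; _~?_)
  other : ∀ {k} (i : Fin (2 ℕ.+ k)) → ∃[ j ] i ≢ j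
  other zero    = suc zero , λ ()
  other (suc _) = zero , λ ()
  nonempty : ∀ {j} {xs : List (Fin _)} → j ∈ xs → 0 ℕ.< length xs
  nonempty (here _)  = s≤s z≤n
  nonempty (there _) = s≤s z≤n
  start : ∃[ j ] i ≢ j → 0 ℕ.< deg G i
  start (j , i≢j) with conn i j
  ... | ε         = ⊥-elim (i≢j refl)
  ... | i~k ◅ _   = nonempty (∈-filter⁺ (i ~?_) (∈-allFin _) i~k)

module Resistance {c ℓ₁ ℓ₂ ℓ₃} (ℝ : RealField c ℓ₁ ℓ₂ ℓ₃) where
  open RealField ℝ public
  open SemiringSum semiring public using (sum; sum-syntax)

  ∑∈ : ∀ {a} {A : Set a} → List A → (A → Carrier) → Carrier
  ∑∈ xs f = List.foldr _+_ 0# (List.map f xs)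

  infixl 10 ∑∈
  syntax ∑∈ xs (λ x → e) = ∑[ x ∈ xs ] e

  Matrix : ℕ → Set c
  Matrix n = Fin n → Fin n → Carrier

  infix 4 _≈ᴹ_
  _≈ᴹ_ : ∀ {n} → Rel (Matrix n) ℓ₁
  A ≈ᴹ B = ∀ i j → A i j ≈ B i j

  infixl 7 _⊗_
  _⊗_ : ∀ {n} → Matrix n → Matrix n → Matrix n
  _⊗_ {n} A B i j = ∑[ k < n ] (A i k * B k j)

  infix 8 _ᵀ
  _ᵀ : ∀ {n} → Matrix n → Matrix n
  (A ᵀ) i j = A j i

  record IsMoorePenroseInverse {n} (A X : Matrix n) : Set ℓ₁ where
    field
      AXA≈A  : A ⊗ X ⊗ A ≈ᴹ A
      XAX≈X  : X ⊗ A ⊗ X ≈ᴹ X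
      AX-sym : (A ⊗ X) ᵀ ≈ᴹ A ⊗ X
      XA-sym : (X ⊗ A) ᵀ ≈ᴹ X ⊗ A

  record IsEigenvector {n} (A : Matrix n) (μ : Carrier) (v : Vector Carrier n)
         : Set (ℓ₁ ⊔ ℓ₂) where
    field
      nonzero : ∃[ i ] v i # 0#
      Av≈μv   : ∀ i → ∑[ j < n ] (A i j * v j) ≈ μ * v i

  ⟨_,_⟩ : ∀ {n} → Vector Carrier n → Vector Carrier n → Carrier
  ⟨_,_⟩ {n} u v = ∑[ i < n ] (u i * v i)

  module _ {n} (G : Graph n) where
    open Graph G using (_~?_)

    adjacency degrees laplacian : Matrix n
    adjacency i j = if ⌊ i ~? j ⌋ then 1# else 0#
    degrees   i j = if ⌊ i ≟ᶠ j ⌋ then deg G i · 1# else 0#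
    laplacian i j = degrees i j - adjacency i j

  -- The argument of the next two definitions is L†.
  resistance : ∀ {n} → Matrix n → Matrix n
  resistance L† i j = L† i i + L† j j - 2 · L† i j

  resistanceDegree : ∀ {n} → Matrix n → Fin n → Carrier
  resistanceDegree {n} L† i = ∑[ j < n ] resistance L† i j

  -- The Moore–Penrose inverse is unique, so ∃ here means "the".
  ResistanceRegular : ∀ {n} → Graph n → Set (c ⊔ ℓ₁)
  ResistanceRegular G = ∃[ L† ] IsMoorePenroseInverse (laplacian G) L† ×
    (∀ i j → resistanceDegree L† i ≈ resistanceDegree L† j)

  -- Rows of S are the eigenvectors; n = suc m, so that fromℕ m is the last index.
  record IsSpectralBasis {m} (L : Matrix (suc m))
         (γ : Vector Carrier (suc m)) (S : Fin (suc m) → Vector Carrier (suc m))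
         : Set (ℓ₁ ⊔ ℓ₂ ⊔ ℓ₃) where
    field
      descending  : ∀ {i j} → i Fin.≤ j → γ j ≤ γ i
      last≈0      : γ (fromℕ m) ≈ 0#
      eigenvector : ∀ i → IsEigenvector L (γ i) (S i)
      normalized  : ∀ i → ⟨ S i , S i ⟩ ≈ 1#
      orthogonal  : ∀ {i j} → i ≢ j → ⟨ S i , S j ⟩ ≈ 0#

{-# OPTIONS --safe #-}
module Submission where

-- Every Moore-Penrose inverse of L equals the matrix
--
--   L⁺ i j = sum over k < m of (1 / γ k) (s k i) (s k j),
--
-- and both sides of the equivalence say that L⁺ has constant diagonal.
--
-- On the one hand the rows of L⁺ sum to 0, so the resistance degree of i is
-- n L⁺ i i + trace L⁺, in which only the first term depends on i
-- (resistanceDegree-formula).  On the other hand L L⁺ is the projection onto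
-- the complement of the constant vectors, with diagonal entries 1 - 1/n
-- (LL⁺-diagonal).  Writing L = D - A turns the i-th of them into
--
--   deg i * L⁺ i i - sum over j in N i of L⁺ i j = 1 - 1/n,
--
-- so the quantity attached to i in the theorem is exactly L⁺ i i (deg*L⁺).
--
-- The facts about the spectrum of L come from the Dirichlet energy v L v, of
-- which the double is the sum over i, j of A i j (v i - v j)².  Along a path
-- joining two vertices at which v is apart, some edge has apart end values, so
-- the energy of v is apart from 0 (energy#0).  Hence the kernel of L consists
-- of the constant vectors (kernel-constant).  The last eigenvector is thus
-- constant, every other one sums to 0, so its entries are not all equal and
-- its eigenvalue, which is its energy, is apart from 0 (γ#0).
--
-- Expanding L and L⁺ in the eigenvectors requires that the square matrix S
-- with orthonormal rows also has orthonormal columns (AAᵀ≈I⇒AᵀA≈I):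
-- P = I - SᵀS is a symmetric idempotent of trace 0, and trace P = trace (PᵀP)
-- is the sum of the squares of the entries of P.
--
-- The argument is constructive: apartness from 0 is always exhibited, never
-- derived from a mere contradiction.

open import Defs
open import Algebra.Bundles using (CommutativeRing)
import Algebra.Apartness.Properties.HeytingCommutativeRing as HCRProperties
import Algebra.Properties.CommutativeSemigroup as CommutativeSemigroupProperties
import Algebra.Properties.Ring as RingProperties
import Algebra.Properties.Semiring.Mult as SemiringMult
import Algebra.Properties.Semiring.Sum as SemiringSum
open import Data.Bool.Base using (if_then_else_)
open import Data.Empty using (⊥-elim)
open import Data.Fin.Base using (Fin; zero; suc; inject₁; fromℕ)
open import Data.Fin.Properties using (fromℕ≢inject₁) renaming (_≟_ to _≟ᶠ_)
open import Data.Fin.Relation.Unary.Top using (view; ‵fromℕ; ‵inject₁)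
open import Data.List.Base as List using (List; filter; tabulate; length)
open import Data.Nat.Base as ℕ using (ℕ; zero; suc; z≤n; s≤s)
open import Data.Product.Base using (Σ-syntax; ∃-syntax; _×_; _,_; proj₁; proj₂)
open import Data.Sum.Base using (_⊎_; inj₁; inj₂)
open import Data.Vec.Functional using (Vector)
open import Function.Base using (_∘_; id)
open import Function.Bundles using (_⇔_; mk⇔)
open import Relation.Binary.Construct.Closure.ReflexiveTransitive using (Star; ε; _◅_)
open import Relation.Binary.PropositionalEquality.Core as ≡ using (_≢_)
import Relation.Binary.Reasoning.Setoid as SetoidReasoning
open import Relation.Binary.Structures using (IsStrictPartialOrder)
open import Relation.Nullary.Decidable.Core using (yes; no; ⌊_⌋)
open import Relation.Nullary.Negation.Core using (¬_)
open import Relation.Unary using (Pred) renaming (Decidable to Decidable₁)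

-- Ordered fields: apartness, inverses, squares and sums of nonnegative terms.
module OrderedField {c ℓ₁ ℓ₂ ℓ₃} (ℝ : RealField c ℓ₁ ℓ₂ ℓ₃) where
  open Resistance ℝ public hiding (zero)
  open CommutativeRing commutativeRing public
    using (ring; *-commutativeSemigroup)
  open RingProperties ring public
    using (-‿distribˡ-*; -‿distribʳ-*; -‿involutive; -0#≈0#; -‿+-comm;
           x∙y⁻¹≈ε⇒x≈y; x≈y⇒x∙y⁻¹≈ε; //-rightDividesˡ; //-rightDividesʳ;
           [y-z]x≈yx-zx; x[y-z]≈xy-xz; +-cancelʳ)
    renaming (⁻¹-anti-homo‿- to -‿anti-homo--)
  open CommutativeSemigroupProperties *-commutativeSemigroup public
    using (x∙yz≈y∙xz; x∙yz≈xz∙y; xy∙z≈xz∙y) renaming (interchange to *-medial)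
  open HCRProperties heytingCommutativeRing public
    using (x-0≈x; x#0y#0→xy#0; #-congʳ)
  open SemiringMult semiring public using (×-assoc-*; ×-congʳ)
  open SemiringSum semiring public
    using (sum-replicate; sum-replicate-zero; sum-init-last; ∑-distrib-+; ∑-comm;
           *-distribˡ-sum; *-distribʳ-sum)
    renaming (sum-cong-≋ to sum-cong)
  open SetoidReasoning setoid public
  open IsStrictPartialOrder isStrictPartialOrder public
    using (<-respˡ-≈; <-respʳ-≈)
    renaming (irrefl to <-irrefl; trans to <-trans; asym to <-asym)

  ≈⇒¬# : ∀ {x y} → x ≈ y → ¬ x # y
  ≈⇒¬# {x} {y} = proj₂ (tight x y)

  ¬#⇒≈ : ∀ {x y} → ¬ x # y → x ≈ y
  ¬#⇒≈ {x} {y} = proj₁ (tight x y)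

  x-y≈z⇒x≈y+z : ∀ {x y z} → x - y ≈ z → x ≈ y + z
  x-y≈z⇒x≈y+z {x} {y} {z} eq = begin
    x         ≈⟨ //-rightDividesˡ y x ⟨
    x - y + y ≈⟨ +-congʳ eq ⟩
    z + y     ≈⟨ +-comm z y ⟩
    y + z     ∎

  #-resp-difference : ∀ {x y z w} → x - y ≈ z - w → x # y → z # w
  #-resp-difference eq x#y with #⇒invertible x#y
  ... | x⁻¹ , invˡ , invʳ = invertible⇒#
    (x⁻¹ , ≈-trans (*-congˡ (≈-sym eq)) invˡ , ≈-trans (*-congʳ (≈-sym eq)) invʳ)

  x+y#y⇒x#0 : ∀ {x y} → x + y # y → x # 0#
  x+y#y⇒x#0 {x} {y} = #-resp-difference (≈-trans (//-rightDividesʳ y x) (≈-sym (x-0≈x x)))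

  x-y#0⇒x#y : ∀ {x y} → x - y # 0# → x # y
  x-y#0⇒x#y = #-resp-difference (x-0≈x _)

  x#y⇒x-y#0 : ∀ {x y} → x # y → x - y # 0#
  x#y⇒x-y#0 = #-resp-difference (≈-sym (x-0≈x _))

  -- Cotransitivity of apartness, in additive form: this is what locates a
  -- witness in a sum without a case distinction on x ≈ 0.
  x+y#0⇒x#0⊎y#0 : ∀ {x y} → x + y # 0# → x # 0# ⊎ y # 0#
  x+y#0⇒x#0⊎y#0 {x} {y} x+y#0 with #-cotrans x+y#0 y
  ... | inj₁ x+y#y = inj₁ (x+y#y⇒x#0 x+y#y)
  ... | inj₂ y#0   = inj₂ y#0

  sum#0⇒term#0 : ∀ {n} (f : Vector Carrier n) → sum f # 0# → ∃[ i ] f i # 0#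
  sum#0⇒term#0 {zero}  f 0#0   = ⊥-elim (≈⇒¬# ≈-refl 0#0)
  sum#0⇒term#0 {suc n} f sum#0 with x+y#0⇒x#0⊎y#0 sum#0
  ... | inj₁ head#0 = zero , head#0
  ... | inj₂ tail#0 with sum#0⇒term#0 (f ∘ suc) tail#0
  ...   | i , fi#0 = suc i , fi#0

  1/-inverseˡ : ∀ {x} (x#0 : x # 0#) → 1/ x [ x#0 ] * x ≈ 1#
  1/-inverseˡ {x} x#0 =
    ≈-trans (*-congˡ (≈-sym (x-0≈x x))) (proj₁ (proj₂ (#⇒invertible x#0)))

  1/x*[x*y]≈y : ∀ {x} (x#0 : x # 0#) y → 1/ x [ x#0 ] * (x * y) ≈ y
  1/x*[x*y]≈y {x} x#0 y = begin
    1/ x [ x#0 ] * (x * y) ≈⟨ *-assoc _ x y ⟨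
    1/ x [ x#0 ] * x * y   ≈⟨ *-congʳ (1/-inverseˡ x#0) ⟩
    1# * y                 ≈⟨ *-identityˡ y ⟩
    y                      ∎

  *-cancelˡ-#0 : ∀ {x y z} → x # 0# → x * y ≈ x * z → y ≈ z
  *-cancelˡ-#0 {x} {y} {z} x#0 eq = begin
    y                      ≈⟨ 1/x*[x*y]≈y x#0 y ⟨
    1/ x [ x#0 ] * (x * y) ≈⟨ *-congˡ eq ⟩
    1/ x [ x#0 ] * (x * z) ≈⟨ 1/x*[x*y]≈y x#0 z ⟩
    z                      ∎

  x≈1/y : ∀ {x y} (y#0 : y # 0#) → y * x ≈ 1# → x ≈ 1/ y [ y#0 ]
  x≈1/y {x} {y} y#0 eq = *-cancelˡ-#0 y#0
    (≈-trans eq (≈-trans (≈-sym (1/-inverseˡ y#0)) (*-comm _ y)))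

  ·≈* : ∀ n x → n · x ≈ (n · 1#) * x
  ·≈* n x = ≈-sym (≈-trans (×-assoc-* n 1# x) (×-congʳ n (*-identityˡ x)))

  x<0⇒0<-x : ∀ {x} → x < 0# → 0# < - x
  x<0⇒0<-x {x} x<0 = <-respˡ-≈ (-‿inverseʳ x)
    (<-respʳ-≈ (+-identityˡ (- x)) (+-monoˡ-< (- x) x<0))

  -x*-x≈x*x : ∀ x → - x * - x ≈ x * x
  -x*-x≈x*x x = begin
    - x * - x     ≈⟨ -‿distribˡ-* x (- x) ⟨
    - (x * - x)   ≈⟨ -‿cong (≈-sym (-‿distribʳ-* x x)) ⟩
    - (- (x * x)) ≈⟨ -‿involutive (x * x) ⟩
    x * x         ∎

  x#0⇒0<x*x : ∀ {x} → x # 0# → 0# < x * x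
  x#0⇒0<x*x {x} x#0 with #⇒<⊎> x#0
  ... | inj₂ 0<x = *-pos 0<x 0<x
  ... | inj₁ x<0 = <-respʳ-≈ (-x*-x≈x*x x) (*-pos (x<0⇒0<-x x<0) (x<0⇒0<-x x<0))

  0≤x*x : ∀ x → 0# ≤ x * x
  0≤x*x x xx<0 = <-irrefl ≈-refl (<-respˡ-≈ xx≈0 xx<0)
    where
    x≈0 : x ≈ 0#
    x≈0 = ¬#⇒≈ λ x#0 → <-asym xx<0 (x#0⇒0<x*x x#0)
    xx≈0 : x * x ≈ 0#
    xx≈0 = ≈-trans (*-congʳ x≈0) (zeroˡ x)

  x*x≈0⇒x≈0 : ∀ {x} → x * x ≈ 0# → x ≈ 0#
  x*x≈0⇒x≈0 xx≈0 = ¬#⇒≈ λ x#0 → <-irrefl (≈-sym xx≈0) (x#0⇒0<x*x x#0)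

  ≤-respʳ-≈ : ∀ {x y z} → y ≈ z → x ≤ y → x ≤ z
  ≤-respʳ-≈ y≈z x≤y z<x = x≤y (<-respˡ-≈ (≈-sym y≈z) z<x)

  -- Since 0 is apart from x, cotransitivity leaves two cases: x + y is apart
  -- from 0 or from x.  The wrong order in either contradicts 0 ≤ y.
  +-pos-nonneg : ∀ {x y} → 0# < x → 0# ≤ y → 0# < x + y
  +-pos-nonneg {x} {y} 0<x 0≤y with #-cotrans (<⇒# 0<x) (x + y)
  ... | inj₁ 0#x+y with #⇒<⊎> 0#x+y
  ...   | inj₁ 0<x+y = 0<x+y
  ...   | inj₂ x+y<0 = ⊥-elim (0≤y (<-trans y<x+y x+y<0))
    where
    y<x+y : y < x + y
    y<x+y = <-respˡ-≈ (+-identityˡ y) (+-monoˡ-< y 0<x)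
  +-pos-nonneg {x} {y} 0<x 0≤y | inj₂ x+y#x with #⇒<⊎> x+y#x
  ...   | inj₂ x<x+y = <-trans 0<x x<x+y
  ...   | inj₁ x+y<x = ⊥-elim (0≤y (<-respˡ-≈ [x+y]-x≈y
                         (<-respʳ-≈ (-‿inverseʳ x) (+-monoˡ-< (- x) x+y<x))))
    where
    [x+y]-x≈y : x + y - x ≈ y
    [x+y]-x≈y = ≈-trans (+-congʳ (+-comm x y)) (//-rightDividesʳ x y)

  +-nonneg : ∀ {x y} → 0# ≤ x → 0# ≤ y → 0# ≤ x + y
  +-nonneg {x} {y} 0≤x 0≤y x+y<0 =
    0≤x (<-respˡ-≈ (≈-trans (+-congˡ (¬#⇒≈ ¬y#0)) (+-identityʳ x)) x+y<0)
    where
    ¬y#0 : ¬ y # 0#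
    ¬y#0 y#0 with #⇒<⊎> y#0
    ... | inj₁ y<0 = 0≤y y<0
    ... | inj₂ 0<y = <-asym x+y<0 (<-respʳ-≈ (+-comm y x) (+-pos-nonneg 0<y 0≤x))

  0≤sum : ∀ {n} {f : Vector Carrier n} → (∀ i → 0# ≤ f i) → 0# ≤ sum f
  0≤sum {zero}  0≤f = <-irrefl ≈-refl
  0≤sum {suc n} 0≤f = +-nonneg (0≤f zero) (0≤sum (0≤f ∘ suc))

  0<sum : ∀ {n} {f : Vector Carrier n} → (∀ i → 0# ≤ f i) → ∀ i → 0# < f i → 0# < sum f
  0<sum 0≤f zero    0<f₀ = +-pos-nonneg 0<f₀ (0≤sum (0≤f ∘ suc))
  0<sum 0≤f (suc i) 0<fᵢ =
    <-respʳ-≈ (+-comm _ _) (+-pos-nonneg (0<sum (0≤f ∘ suc) i 0<fᵢ) (0≤f zero))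

  sum≈0⇒term≈0 : ∀ {n} {f : Vector Carrier n} →
                 (∀ i → 0# ≤ f i) → sum f ≈ 0# → ∀ i → f i ≈ 0#
  sum≈0⇒term≈0 0≤f sum≈0 i = ¬#⇒≈ ¬fᵢ#0
    where
    ¬fᵢ#0 : ¬ _ # 0#
    ¬fᵢ#0 fᵢ#0 with #⇒<⊎> fᵢ#0
    ... | inj₁ fᵢ<0 = 0≤f i fᵢ<0
    ... | inj₂ 0<fᵢ = <-irrefl (≈-sym sum≈0) (0<sum 0≤f i 0<fᵢ)

-- Finite sums and extension of vectors by a last entry.
module FiniteSums {c ℓ₁ ℓ₂ ℓ₃} (ℝ : RealField c ℓ₁ ℓ₂ ℓ₃) where
  open OrderedField ℝ

  sum-0 : ∀ {n} {f : Vector Carrier n} → (∀ i → f i ≈ 0#) → sum f ≈ 0#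
  sum-0 {n} f≈0 = ≈-trans (sum-cong f≈0) (sum-replicate-zero n)

  sum-const : ∀ n x → ∑[ i < n ] x ≈ (n · 1#) * x
  sum-const n x = ≈-trans (sum-replicate n) (·≈* n x)

  sum-neg : ∀ {n} (f : Vector Carrier n) → ∑[ i < n ] (- f i) ≈ - sum f
  sum-neg {zero}  f = ≈-sym -0#≈0#
  sum-neg {suc n} f = ≈-trans (+-congˡ (sum-neg (f ∘ suc))) (-‿+-comm _ _)

  sum-diff : ∀ {n} (f g : Vector Carrier n) →
             ∑[ i < n ] (f i - g i) ≈ sum f - sum g
  sum-diff f g = ≈-trans (∑-distrib-+ f (λ i → - g i)) (+-congˡ (sum-neg g))

  ∑∈-cong : ∀ {a} {X : Set a} (xs : List X) {f g : X → Carrier} →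
            (∀ x → f x ≈ g x) → ∑∈ xs f ≈ ∑∈ xs g
  ∑∈-cong List.[]       f≈g = ≈-refl
  ∑∈-cong (x List.∷ xs) f≈g = +-cong (f≈g x) (∑∈-cong xs f≈g)

  length-·-1 : ∀ {a} {X : Set a} (xs : List X) → length xs · 1# ≈ ∑[ x ∈ xs ] 1#
  length-·-1 List.[]       = ≈-refl
  length-·-1 (x List.∷ xs) = +-congˡ (length-·-1 xs)

  ∑∈-filter-tabulate : ∀ {a p} {X : Set a} {P : Pred X p} (P? : Decidable₁ P)
    {k} (g : Fin k → X) (f : X → Carrier) →
    ∑∈ (filter P? (tabulate g)) f ≈
    ∑[ j < k ] ((if ⌊ P? (g j) ⌋ then 1# else 0#) * f (g j))
  ∑∈-filter-tabulate P? {zero}  g f = ≈-refl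
  ∑∈-filter-tabulate P? {suc k} g f with P? (g zero)
  ... | yes _ = +-cong (≈-sym (*-identityˡ _)) (∑∈-filter-tabulate P? (g ∘ suc) f)
  ... | no  _ = ≈-trans (∑∈-filter-tabulate P? (g ∘ suc) f)
                  (≈-trans (≈-sym (+-identityˡ _)) (+-congʳ (≈-sym (zeroˡ _))))

  -- f followed by the entry x, at index fromℕ n.
  snoc : ∀ {n} → Vector Carrier n → Carrier → Vector Carrier (suc n)
  snoc {zero}  f x _       = x
  snoc {suc n} f x zero    = f zero
  snoc {suc n} f x (suc i) = snoc (f ∘ suc) x i

  snoc-inject₁ : ∀ {n} (f : Vector Carrier n) x i → snoc f x (inject₁ i) ≈ f i
  snoc-inject₁ {suc n} f x zero    = ≈-refl
  snoc-inject₁ {suc n} f x (suc i) = snoc-inject₁ (f ∘ suc) x i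

  snoc-fromℕ : ∀ {n} (f : Vector Carrier n) x → snoc f x (fromℕ n) ≈ x
  snoc-fromℕ {zero}  f x = ≈-refl
  snoc-fromℕ {suc n} f x = snoc-fromℕ (f ∘ suc) x

  sum-drop-last : ∀ {n} (f : Vector Carrier (suc n)) (g : Vector Carrier n) →
    (∀ i → f (inject₁ i) ≈ g i) → f (fromℕ n) ≈ 0# → sum f ≈ sum g
  sum-drop-last f g f≈g last≈0 = ≈-trans (sum-init-last f)
    (≈-trans (+-cong (sum-cong f≈g) last≈0) (+-identityʳ (sum g)))

  -- Induction over the indices other than the last one.
  ≢last-elim : ∀ {p m} (P : Fin (suc m) → Set p) →
               (∀ k → P (inject₁ k)) → ∀ {k} → k ≢ fromℕ m → P k
  ≢last-elim P inject₁-case {k} k≢last with view k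
  ... | ‵fromℕ     = ⊥-elim (k≢last ≡.refl)
  ... | ‵inject₁ i = inject₁-case i

-- Matrices, traces and Moore-Penrose inverses.
module MatrixAlgebra {c ℓ₁ ℓ₂ ℓ₃} (ℝ : RealField c ℓ₁ ℓ₂ ℓ₃) where
  open OrderedField ℝ
  open FiniteSums ℝ

  -- x on the diagonal and 0 elsewhere.  The degree matrix of a graph has, in
  -- row i, the entries of scalar (deg i · 1#), whence the sum-scalar lemma in
  -- this generality.
  scalar : ∀ {n} → Carrier → Matrix n
  scalar x i j = if ⌊ i ≟ᶠ j ⌋ then x else 0#

  -- The identity matrix.
  I : ∀ {n} → Matrix n
  I = scalar 1#

  scalar-diag : ∀ {n} x (i : Fin n) → scalar x i i ≈ x
  scalar-diag x i with i ≟ᶠ i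
  ... | yes _  = ≈-refl
  ... | no i≢i = ⊥-elim (i≢i ≡.refl)

  scalar-off-diag : ∀ {n} x {i j : Fin n} → i ≢ j → scalar x i j ≈ 0#
  scalar-off-diag x {i} {j} i≢j with i ≟ᶠ j
  ... | yes i≡j = ⊥-elim (i≢j i≡j)
  ... | no _    = ≈-refl

  scalar-suc : ∀ {n} x (i j : Fin n) → scalar x (suc i) (suc j) ≈ scalar x i j
  scalar-suc x i j with i ≟ᶠ j
  ... | yes _ = ≈-refl
  ... | no _  = ≈-refl

  I-sym : ∀ {n} (i j : Fin n) → I i j ≈ I j i
  I-sym i j with i ≟ᶠ j
  ... | yes ≡.refl = ≈-sym (scalar-diag 1# i)
  ... | no i≢j     = ≈-sym (scalar-off-diag 1# (i≢j ∘ ≡.sym))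

  sum-scalar : ∀ {n} x (i : Fin n) (f : Vector Carrier n) →
               ∑[ j < n ] (scalar x i j * f j) ≈ x * f i
  sum-scalar x zero f =
    ≈-trans (+-congˡ (sum-0 λ j → zeroˡ (f (suc j)))) (+-identityʳ _)
  sum-scalar {suc n} x (suc i) f = begin
    0# * f zero + ∑[ j < n ] (scalar x (suc i) (suc j) * f (suc j))
      ≈⟨ +-cong (zeroˡ _) (sum-cong λ j → *-congʳ (scalar-suc x i j)) ⟩
    0# + ∑[ j < n ] (scalar x i j * f (suc j))
      ≈⟨ +-identityˡ _ ⟩
    ∑[ j < n ] (scalar x i j * f (suc j))
      ≈⟨ sum-scalar x i (f ∘ suc) ⟩
    x * f (suc i) ∎

  sum-I : ∀ {n} (i : Fin n) (f : Vector Carrier n) → ∑[ j < n ] (I i j * f j) ≈ f i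
  sum-I i f = ≈-trans (sum-scalar 1# i f) (*-identityˡ (f i))

  ≈ᴹ-sym : ∀ {n} {A B : Matrix n} → A ≈ᴹ B → B ≈ᴹ A
  ≈ᴹ-sym eq i j = ≈-sym (eq i j)

  ≈ᴹ-trans : ∀ {n} {A B C : Matrix n} → A ≈ᴹ B → B ≈ᴹ C → A ≈ᴹ C
  ≈ᴹ-trans eq₁ eq₂ i j = ≈-trans (eq₁ i j) (eq₂ i j)

  ⊗-cong : ∀ {n} {A A′ B B′ : Matrix n} → A ≈ᴹ A′ → B ≈ᴹ B′ → A ⊗ B ≈ᴹ A′ ⊗ B′
  ⊗-cong A≈A′ B≈B′ i j = sum-cong λ k → *-cong (A≈A′ i k) (B≈B′ k j)

  ⊗-congˡ : ∀ {n} (A : Matrix n) {B B′ : Matrix n} → B ≈ᴹ B′ → A ⊗ B ≈ᴹ A ⊗ B′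
  ⊗-congˡ A = ⊗-cong {A = A} (λ _ _ → ≈-refl)

  ⊗-congʳ : ∀ {n} {A A′ : Matrix n} (B : Matrix n) → A ≈ᴹ A′ → A ⊗ B ≈ᴹ A′ ⊗ B
  ⊗-congʳ B A≈A′ = ⊗-cong {B = B} A≈A′ (λ _ _ → ≈-refl)

  ⊗-assoc : ∀ {n} (A B C : Matrix n) → (A ⊗ B) ⊗ C ≈ᴹ A ⊗ (B ⊗ C)
  ⊗-assoc {n} A B C i j = begin
    ∑[ l < n ] ((∑[ k < n ] (A i k * B k l)) * C l j)
      ≈⟨ sum-cong (λ l → *-distribʳ-sum {n} (C l j) _) ⟩
    ∑[ l < n ] (∑[ k < n ] (A i k * B k l * C l j))
      ≈⟨ ∑-comm (λ l k → A i k * B k l * C l j) ⟩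
    ∑[ k < n ] (∑[ l < n ] (A i k * B k l * C l j))
      ≈⟨ sum-cong (λ k → sum-cong λ l → *-assoc (A i k) (B k l) (C l j)) ⟩
    ∑[ k < n ] (∑[ l < n ] (A i k * (B k l * C l j)))
      ≈⟨ sum-cong (λ k → *-distribˡ-sum {n} (A i k) _) ⟨
    ∑[ k < n ] (A i k * (∑[ l < n ] (B k l * C l j))) ∎

  ᵀ-⊗ : ∀ {n} (A B : Matrix n) → (A ⊗ B) ᵀ ≈ᴹ (B ᵀ) ⊗ (A ᵀ)
  ᵀ-⊗ A B i j = sum-cong λ k → *-comm (A j k) (B k i)

  ⊗-identityˡ : ∀ {n} (A : Matrix n) → I ⊗ A ≈ᴹ A
  ⊗-identityˡ A i j = sum-I i (λ k → A k j)

  ⊗-identityʳ : ∀ {n} (A : Matrix n) → A ⊗ I ≈ᴹ A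
  ⊗-identityʳ A i j =
    ≈-trans (sum-cong λ k → ≈-trans (*-comm (A i k) _) (*-congʳ (I-sym k j)))
            (sum-I j (A i))

  trace : ∀ {n} → Matrix n → Carrier
  trace {n} A = ∑[ i < n ] A i i

  trace-comm : ∀ {n} (A B : Matrix n) → trace (A ⊗ B) ≈ trace (B ⊗ A)
  trace-comm A B = ≈-trans (∑-comm (λ i k → A i k * B k i))
    (sum-cong λ k → sum-cong λ i → *-comm (A i k) (B k i))

  trace-cong : ∀ {n} {A B : Matrix n} → A ≈ᴹ B → trace A ≈ trace B
  trace-cong A≈B = sum-cong λ i → A≈B i i

  -- The sum of the squares of the entries of P is trace (P ⊗ P) = trace P.
  projection≈0 : ∀ {n} (P : Matrix n) → P ᵀ ≈ᴹ P → P ⊗ P ≈ᴹ P → trace P ≈ 0# →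
                 ∀ i j → P i j ≈ 0#
  projection≈0 {n} P P-sym P-idem trP≈0 i j =
    x*x≈0⇒x≈0 (sum≈0⇒term≈0 (λ j → 0≤x*x (P i j)) row≈0 j)
    where
    squares : ∑[ i < n ] (∑[ j < n ] (P i j * P i j)) ≈ 0#
    squares = ≈-trans
      (sum-cong λ i → ≈-trans (sum-cong λ j → *-congˡ (P-sym j i)) (P-idem i i)) trP≈0
    row≈0 : ∑[ j < n ] (P i j * P i j) ≈ 0#
    row≈0 = sum≈0⇒term≈0 (λ i → 0≤sum λ j → 0≤x*x (P i j)) squares i

  -- I - AᵀA is a symmetric idempotent, of trace 0 because AᵀA and AAᵀ have the
  -- same trace.  No dimension count or determinant is involved.
  AAᵀ≈I⇒AᵀA≈I : ∀ {n} (A : Matrix n) → A ⊗ A ᵀ ≈ᴹ I → A ᵀ ⊗ A ≈ᴹ I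
  AAᵀ≈I⇒AᵀA≈I {n} A AAᵀ≈I i j =
    ≈-sym (x∙y⁻¹≈ε⇒x≈y _ _ (projection≈0 P P-sym P-idem trP≈0 i j))
    where
    Q P : Matrix n
    Q = A ᵀ ⊗ A
    P i j = I i j - Q i j
    Q-sym : Q ᵀ ≈ᴹ Q
    Q-sym = ᵀ-⊗ (A ᵀ) A
    P-sym : P ᵀ ≈ᴹ P
    P-sym i j = +-cong (I-sym j i) (-‿cong (Q-sym i j))
    AQ≈A : A ⊗ Q ≈ᴹ A
    AQ≈A = ≈ᴹ-trans (≈ᴹ-sym (⊗-assoc A (A ᵀ) A))
             (≈ᴹ-trans (⊗-congʳ A AAᵀ≈I) (⊗-identityˡ A))
    QQ≈Q : Q ⊗ Q ≈ᴹ Q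
    QQ≈Q = ≈ᴹ-trans (⊗-assoc (A ᵀ) A Q) (⊗-congˡ (A ᵀ) AQ≈A)
    PQ≈0 : ∀ i j → (P ⊗ Q) i j ≈ 0#
    PQ≈0 i j = begin
      ∑[ k < n ] (P i k * Q k j)
        ≈⟨ sum-cong (λ k → [y-z]x≈yx-zx (Q k j) (I i k) (Q i k)) ⟩
      ∑[ k < n ] (I i k * Q k j - Q i k * Q k j)
        ≈⟨ sum-diff _ (λ k → Q i k * Q k j) ⟩
      (I ⊗ Q) i j - (Q ⊗ Q) i j
        ≈⟨ x≈y⇒x∙y⁻¹≈ε (≈-trans (⊗-identityˡ Q i j) (≈-sym (QQ≈Q i j))) ⟩
      0# ∎
    P-idem : P ⊗ P ≈ᴹ P
    P-idem i j = begin
      ∑[ k < n ] (P i k * P k j)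
        ≈⟨ sum-cong (λ k → x[y-z]≈xy-xz (P i k) (I k j) (Q k j)) ⟩
      ∑[ k < n ] (P i k * I k j - P i k * Q k j)
        ≈⟨ sum-diff _ (λ k → P i k * Q k j) ⟩
      (P ⊗ I) i j - (P ⊗ Q) i j
        ≈⟨ +-cong (⊗-identityʳ P i j) (-‿cong (PQ≈0 i j)) ⟩
      P i j - 0#
        ≈⟨ x-0≈x (P i j) ⟩
      P i j ∎
    trP≈0 : trace P ≈ 0#
    trP≈0 = ≈-trans (sum-diff (λ i → I i i) (λ i → Q i i))
      (x≈y⇒x∙y⁻¹≈ε (≈-sym (≈-trans (trace-comm (A ᵀ) A) (trace-cong AAᵀ≈I))))

  module _ {n} {A X Y : Matrix n}
           (mpX : IsMoorePenroseInverse A X) (mpY : IsMoorePenroseInverse A Y) where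
    private
      module X = IsMoorePenroseInverse mpX
      module Y = IsMoorePenroseInverse mpY

    -- A X and A Y are symmetric, so (A Y)(A X) = A X is the transpose of
    -- (A X)(A Y) = A Y.
    mp-AX≈AY : A ⊗ X ≈ᴹ A ⊗ Y
    mp-AX≈AY i j = begin
      (A ⊗ X) i j                     ≈⟨ ⊗-congʳ X Y.AXA≈A i j ⟨
      (A ⊗ Y ⊗ A ⊗ X) i j             ≈⟨ ⊗-assoc (A ⊗ Y) A X i j ⟩
      ((A ⊗ Y) ⊗ (A ⊗ X)) i j         ≈⟨ ⊗-cong Y.AX-sym X.AX-sym i j ⟨
      ((A ⊗ Y) ᵀ ⊗ (A ⊗ X) ᵀ) i j     ≈⟨ ᵀ-⊗ (A ⊗ X) (A ⊗ Y) i j ⟨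
      ((A ⊗ X) ⊗ (A ⊗ Y)) j i         ≈⟨ ⊗-assoc (A ⊗ X) A Y j i ⟨
      (A ⊗ X ⊗ A ⊗ Y) j i             ≈⟨ ⊗-congʳ Y X.AXA≈A j i ⟩
      (A ⊗ Y) j i                     ≈⟨ Y.AX-sym i j ⟩
      (A ⊗ Y) i j                     ∎

    mp-XA≈YA : X ⊗ A ≈ᴹ Y ⊗ A
    mp-XA≈YA i j = begin
      (X ⊗ A) i j                     ≈⟨ ⊗-congˡ X Y.AXA≈A i j ⟨
      (X ⊗ (A ⊗ Y ⊗ A)) i j           ≈⟨ ⊗-congˡ X (⊗-assoc A Y A) i j ⟩
      (X ⊗ (A ⊗ (Y ⊗ A))) i j         ≈⟨ ⊗-assoc X A (Y ⊗ A) i j ⟨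
      ((X ⊗ A) ⊗ (Y ⊗ A)) i j         ≈⟨ ⊗-cong X.XA-sym Y.XA-sym i j ⟨
      ((X ⊗ A) ᵀ ⊗ (Y ⊗ A) ᵀ) i j     ≈⟨ ᵀ-⊗ (Y ⊗ A) (X ⊗ A) i j ⟨
      ((Y ⊗ A) ⊗ (X ⊗ A)) j i         ≈⟨ ⊗-assoc Y A (X ⊗ A) j i ⟩
      (Y ⊗ (A ⊗ (X ⊗ A))) j i         ≈⟨ ⊗-congˡ Y (⊗-assoc A X A) j i ⟨
      (Y ⊗ (A ⊗ X ⊗ A)) j i           ≈⟨ ⊗-congˡ Y X.AXA≈A j i ⟩
      (Y ⊗ A) j i                     ≈⟨ Y.XA-sym i j ⟩
      (Y ⊗ A) i j                     ∎

    moorePenrose-unique : X ≈ᴹ Y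
    moorePenrose-unique i j = begin
      X i j               ≈⟨ X.XAX≈X i j ⟨
      (X ⊗ A ⊗ X) i j     ≈⟨ ⊗-congʳ X mp-XA≈YA i j ⟩
      (Y ⊗ A ⊗ X) i j     ≈⟨ ⊗-assoc Y A X i j ⟩
      (Y ⊗ (A ⊗ X)) i j   ≈⟨ ⊗-congˡ Y mp-AX≈AY i j ⟩
      (Y ⊗ (A ⊗ Y)) i j   ≈⟨ ⊗-assoc Y A Y i j ⟨
      (Y ⊗ A ⊗ Y) i j     ≈⟨ Y.XAX≈X i j ⟩
      Y i j               ∎

-- Resistance degrees computed from a candidate for the inverse.
module ResistanceDegree {c ℓ₁ ℓ₂ ℓ₃} (ℝ : RealField c ℓ₁ ℓ₂ ℓ₃) where
  open OrderedField ℝ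
  open FiniteSums ℝ
  open MatrixAlgebra ℝ

  resistanceDegree-formula : ∀ {n} {X : Matrix n} → (∀ i → ∑[ j < n ] X i j ≈ 0#) →
    ∀ i → resistanceDegree X i ≈ (n · 1#) * X i i + trace X
  resistanceDegree-formula {n} {X} rowSum i = begin
    ∑[ j < n ] (X i i + X j j - 2 · X i j)
      ≈⟨ sum-diff (λ j → X i i + X j j) (λ j → 2 · X i j) ⟩
    ∑[ j < n ] (X i i + X j j) - ∑[ j < n ] (2 · X i j)
      ≈⟨ +-cong (∑-distrib-+ (λ _ → X i i) (λ j → X j j)) (-‿cong double≈0) ⟩
    ∑[ j < n ] X i i + trace X - 0#
      ≈⟨ x-0≈x _ ⟩
    ∑[ j < n ] X i i + trace X
      ≈⟨ +-congʳ (sum-const n (X i i)) ⟩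
    (n · 1#) * X i i + trace X ∎
    where
    double≈0 : ∑[ j < n ] (2 · X i j) ≈ 0#
    double≈0 = begin
      ∑[ j < n ] (2 · X i j)
        ≈⟨ sum-cong (λ j → ·≈* 2 (X i j)) ⟩
      ∑[ j < n ] (2 · 1# * X i j)
        ≈⟨ *-distribˡ-sum (2 · 1#) (X i) ⟨
      2 · 1# * (∑[ j < n ] X i j)
        ≈⟨ ≈-trans (*-congˡ (rowSum i)) (zeroʳ _) ⟩
      0# ∎

  resistanceDegree-cong : ∀ {n} {X Y : Matrix n} → X ≈ᴹ Y →
    ∀ i → resistanceDegree X i ≈ resistanceDegree Y i
  resistanceDegree-cong X≈Y i = sum-cong λ j →
    +-cong (+-cong (X≈Y i i) (X≈Y j j)) (-‿cong (×-congʳ 2 (X≈Y i j)))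

-- The Laplacian and its Dirichlet energy.
module LaplacianForm {c ℓ₁ ℓ₂ ℓ₃} (ℝ : RealField c ℓ₁ ℓ₂ ℓ₃) {n} (G : Graph n) where
  open OrderedField ℝ
  open FiniteSums ℝ
  open MatrixAlgebra ℝ
  open Graph G using (_~_; _~?_; ~-sym)

  private
    A L : Matrix n
    A = adjacency G
    L = laplacian G

  ∑∈N : ∀ i (f : Vector Carrier n) → ∑∈ (N G i) f ≈ ∑[ j < n ] (A i j * f j)
  ∑∈N i f = ∑∈-filter-tabulate (i ~?_) id f

  deg≈∑A : ∀ i → deg G i · 1# ≈ ∑[ j < n ] A i j
  deg≈∑A i = ≈-trans (length-·-1 (N G i))
    (≈-trans (∑∈N i (λ _ → 1#)) (sum-cong λ j → *-identityʳ (A i j)))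

  A-edge : ∀ {i j} → i ~ j → A i j ≈ 1#
  A-edge {i} {j} i~j with i ~? j
  ... | yes _   = ≈-refl
  ... | no ¬i~j = ⊥-elim (¬i~j i~j)

  A-nonEdge : ∀ {i j} → ¬ i ~ j → A i j ≈ 0#
  A-nonEdge {i} {j} ¬i~j with i ~? j
  ... | yes i~j = ⊥-elim (¬i~j i~j)
  ... | no _    = ≈-refl

  A-sym : ∀ i j → A i j ≈ A j i
  A-sym i j with i ~? j
  ... | yes i~j = ≈-sym (A-edge (~-sym i~j))
  ... | no ¬i~j = ≈-sym (A-nonEdge (¬i~j ∘ ~-sym))

  L-apply : ∀ i (v : Vector Carrier n) →
            ∑[ j < n ] (L i j * v j) ≈ (deg G i · 1#) * v i - ∑∈ (N G i) v
  L-apply i v = begin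
    ∑[ j < n ] (L i j * v j)
      ≈⟨ sum-cong (λ j → [y-z]x≈yx-zx (v j) (degrees G i j) (A i j)) ⟩
    ∑[ j < n ] (degrees G i j * v j - A i j * v j)
      ≈⟨ sum-diff (λ j → degrees G i j * v j) (λ j → A i j * v j) ⟩
    ∑[ j < n ] (degrees G i j * v j) - ∑[ j < n ] (A i j * v j)
      ≈⟨ +-cong (sum-scalar (deg G i · 1#) i v) (-‿cong (≈-sym (∑∈N i v))) ⟩
    (deg G i · 1#) * v i - ∑∈ (N G i) v ∎

  L-apply-differences : ∀ i (v : Vector Carrier n) →
    ∑[ j < n ] (L i j * v j) ≈ ∑[ j < n ] (A i j * (v i - v j))
  L-apply-differences i v = begin
    ∑[ j < n ] (L i j * v j)
      ≈⟨ L-apply i v ⟩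
    (deg G i · 1#) * v i - ∑∈ (N G i) v
      ≈⟨ +-cong (*-congʳ (deg≈∑A i)) (-‿cong (∑∈N i v)) ⟩
    (∑[ j < n ] A i j) * v i - ∑[ j < n ] (A i j * v j)
      ≈⟨ +-congʳ (*-distribʳ-sum (v i) (A i)) ⟩
    ∑[ j < n ] (A i j * v i) - ∑[ j < n ] (A i j * v j)
      ≈⟨ sum-diff (λ j → A i j * v i) (λ j → A i j * v j) ⟨
    ∑[ j < n ] (A i j * v i - A i j * v j)
      ≈⟨ sum-cong (λ j → x[y-z]≈xy-xz (A i j) (v i) (v j)) ⟨
    ∑[ j < n ] (A i j * (v i - v j)) ∎

  -- The Dirichlet energy: the quadratic form of the Laplacian at v.
  energy : Vector Carrier n → Carrier
  energy v = ⟨ v , (λ i → ∑[ j < n ] (L i j * v j)) ⟩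

  private
    x[x-y]+y[y-x] : ∀ x y → x * (x - y) + y * (y - x) ≈ (x - y) * (x - y)
    x[x-y]+y[y-x] x y = begin
      x * (x - y) + y * (y - x)     ≈⟨ +-congˡ (*-congˡ (-‿anti-homo-- x y)) ⟨
      x * (x - y) + y * - (x - y)   ≈⟨ +-congˡ (-‿distribʳ-* y (x - y)) ⟨
      x * (x - y) - y * (x - y)     ≈⟨ [y-z]x≈yx-zx (x - y) x y ⟨
      (x - y) * (x - y)             ∎

  2energy : ∀ v → energy v + energy v ≈
            ∑[ i < n ] (∑[ j < n ] (A i j * ((v i - v j) * (v i - v j))))
  2energy v = begin
    energy v + energy v
      ≈⟨ +-cong expand (≈-trans expand swap) ⟩
    ∑[ i < n ] (∑[ j < n ] e i j) + ∑[ i < n ] (∑[ j < n ] e′ i j)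
      ≈⟨ ∑-distrib-+ (λ i → ∑[ j < n ] e i j) (λ i → ∑[ j < n ] e′ i j) ⟨
    ∑[ i < n ] ((∑[ j < n ] e i j) + (∑[ j < n ] e′ i j))
      ≈⟨ sum-cong (λ i → ≈-sym (∑-distrib-+ (e i) (e′ i))) ⟩
    ∑[ i < n ] (∑[ j < n ] (e i j + e′ i j))
      ≈⟨ sum-cong (λ i → sum-cong λ j → collect i j) ⟩
    ∑[ i < n ] (∑[ j < n ] (A i j * ((v i - v j) * (v i - v j)))) ∎
    where
    -- The (i , j) summand of the energy and, by symmetry of A, the (j , i) one.
    e e′ : Matrix n
    e  i j = A i j * (v i * (v i - v j))
    e′ i j = A i j * (v j * (v j - v i))
    expand : energy v ≈ ∑[ i < n ] (∑[ j < n ] e i j)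
    expand = sum-cong λ i → begin
      v i * (∑[ j < n ] (L i j * v j))
        ≈⟨ *-congˡ (L-apply-differences i v) ⟩
      v i * (∑[ j < n ] (A i j * (v i - v j)))
        ≈⟨ *-distribˡ-sum (v i) (λ j → A i j * (v i - v j)) ⟩
      ∑[ j < n ] (v i * (A i j * (v i - v j)))
        ≈⟨ sum-cong (λ j → x∙yz≈y∙xz (v i) (A i j) (v i - v j)) ⟩
      ∑[ j < n ] e i j ∎
    swap : ∑[ i < n ] (∑[ j < n ] e i j) ≈ ∑[ i < n ] (∑[ j < n ] e′ i j)
    swap = ≈-trans (∑-comm e) (sum-cong λ i → sum-cong λ j → *-congʳ (A-sym j i))
    collect : ∀ i j → e i j + e′ i j ≈ A i j * ((v i - v j) * (v i - v j))
    collect i j = ≈-trans (≈-sym (distribˡ (A i j) _ _))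
                    (*-congˡ (x[x-y]+y[y-x] (v i) (v j)))

  A-weighted-square-nonneg : ∀ (v : Vector Carrier n) i j →
                             0# ≤ A i j * ((v i - v j) * (v i - v j))
  A-weighted-square-nonneg v i j with i ~? j
  ... | yes _ = ≤-respʳ-≈ (≈-sym (*-identityˡ _)) (0≤x*x (v i - v j))
  ... | no  _ = <-irrefl (zeroˡ _)

  -- By cotransitivity, v k is apart from v i or from v j at the first step k of
  -- the path; in the second case the search continues from k.
  path⇒edge# : ∀ (v : Vector Carrier n) {i j} → Star _~_ i j → v i # v j →
               ∃[ k ] ∃[ l ] k ~ l × v k # v l
  path⇒edge# v ε vi#vj = ⊥-elim (≈⇒¬# ≈-refl vi#vj)
  path⇒edge# v {i} (_◅_ {j = k} i~k path) vi#vj with #-cotrans vi#vj (v k)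
  ... | inj₁ vi#vk = i , k , i~k , vi#vk
  ... | inj₂ vk#vj = path⇒edge# v path vk#vj

  -- On an edge given by path⇒edge# the summand of twice the energy is positive,
  -- and all the others are nonnegative.
  energy#0 : Connected G → ∀ v {i j} → v i # v j → energy v # 0#
  energy#0 conn v {i} {j} vi#vj with path⇒edge# v (conn i j) vi#vj
  ... | k , l , k~l , vk#vl with x+y#0⇒x#0⊎y#0
    (#-congʳ (≈-sym (2energy v)) (#-sym (<⇒# 0<sums)))
    where
    0<edge : 0# < A k l * ((v k - v l) * (v k - v l))
    0<edge = <-respʳ-≈ (≈-sym (≈-trans (*-congʳ (A-edge k~l)) (*-identityˡ _)))
               (x#0⇒0<x*x (x#y⇒x-y#0 vk#vl))
    0<sums : 0# < ∑[ i < n ] (∑[ j < n ] (A i j * ((v i - v j) * (v i - v j))))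
    0<sums = 0<sum (λ i → 0≤sum (A-weighted-square-nonneg v i)) k
               (0<sum (A-weighted-square-nonneg v k) l 0<edge)
  ...   | inj₁ e#0 = e#0
  ...   | inj₂ e#0 = e#0

  -- By tightness of apartness, from energy#0.
  kernel-constant : Connected G → ∀ v →
    (∀ i → ∑[ j < n ] (L i j * v j) ≈ 0#) → ∀ i j → v i ≈ v j
  kernel-constant conn v Lv≈0 i j = ¬#⇒≈ λ vi#vj →
    ≈⇒¬# (sum-0 λ i → ≈-trans (*-congˡ (Lv≈0 i)) (zeroʳ (v i))) (energy#0 conn v vi#vj)

-- Functional calculus in an orthonormal basis: the rows of S.
module OrthonormalBasis {c ℓ₁ ℓ₂ ℓ₃} (ℝ : RealField c ℓ₁ ℓ₂ ℓ₃) {n}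
                        (S : Resistance.Matrix ℝ n)
                        (SSᵀ≈I : Resistance._≈ᴹ_ ℝ (Resistance._⊗_ ℝ S (Resistance._ᵀ ℝ S))
                                                   (MatrixAlgebra.I ℝ)) where
  open OrderedField ℝ
  open FiniteSums ℝ
  open MatrixAlgebra ℝ

  -- The matrix Sᵀ diag(f).
  scaleColumns : Vector Carrier n → Matrix n
  scaleColumns f i k = f k * S k i

  -- The matrix Sᵀ diag(f) S, with eigenvalue f k on the k-th row of S: the
  -- entry at i, j is the sum over k of f k * S k i * S k j.
  spec : Vector Carrier n → Matrix n
  spec f = scaleColumns f ⊗ S

  spec-cong : ∀ {f g : Vector Carrier n} → (∀ k → f k ≈ g k) → spec f ≈ᴹ spec g
  spec-cong f≈g i j = sum-cong λ k → *-congʳ (*-congʳ (f≈g k))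

  spec-sym : ∀ f → spec f ᵀ ≈ᴹ spec f
  spec-sym f i j = sum-cong λ k → xy∙z≈xz∙y (f k) (S k j) (S k i)

  S-spec : ∀ f k j → (S ⊗ spec f) k j ≈ f k * S k j
  S-spec f k j = begin
    (S ⊗ spec f) k j
      ≈⟨ ⊗-assoc S (scaleColumns f) S k j ⟨
    (S ⊗ scaleColumns f ⊗ S) k j
      ≈⟨ sum-cong (λ p → *-congʳ (pull p)) ⟩
    ∑[ p < n ] (I k p * f p * S p j)
      ≈⟨ sum-cong (λ p → *-assoc (I k p) (f p) (S p j)) ⟩
    ∑[ p < n ] (I k p * (f p * S p j))
      ≈⟨ sum-I k (λ p → f p * S p j) ⟩
    f k * S k j ∎
    where
    pull : ∀ p → (S ⊗ scaleColumns f) k p ≈ I k p * f p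
    pull p = begin
      ∑[ l < n ] (S k l * (f p * S p l))
        ≈⟨ sum-cong (λ l → x∙yz≈xz∙y (S k l) (f p) (S p l)) ⟩
      ∑[ l < n ] (S k l * S p l * f p)
        ≈⟨ *-distribʳ-sum (f p) (λ l → S k l * S p l) ⟨
      (∑[ l < n ] (S k l * S p l)) * f p
        ≈⟨ *-congʳ (SSᵀ≈I k p) ⟩
      I k p * f p ∎

  spec-⊗ : ∀ f g → spec f ⊗ spec g ≈ᴹ spec (λ k → f k * g k)
  spec-⊗ f g i j = begin
    (spec f ⊗ spec g) i j
      ≈⟨ ⊗-assoc (scaleColumns f) S (spec g) i j ⟩
    (scaleColumns f ⊗ (S ⊗ spec g)) i j
      ≈⟨ sum-cong (λ k → *-congˡ (S-spec g k j)) ⟩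
    ∑[ k < n ] (f k * S k i * (g k * S k j))
      ≈⟨ sum-cong (λ k → *-medial (f k) (S k i) (g k) (S k j)) ⟩
    ∑[ k < n ] (f k * g k * (S k i * S k j))
      ≈⟨ sum-cong (λ k → *-assoc (f k * g k) (S k i) (S k j)) ⟨
    spec (λ k → f k * g k) i j ∎

  SᵀS≈I : S ᵀ ⊗ S ≈ᴹ I
  SᵀS≈I = AAᵀ≈I⇒AᵀA≈I S SSᵀ≈I

  -- A matrix with the rows of S as eigenvectors.
  module _ {A : Matrix n} {γ : Vector Carrier n}
           (Av≈γv : ∀ k i → ∑[ j < n ] (A i j * S k j) ≈ γ k * S k i) where

    spectral-decomposition : A ≈ᴹ spec γ
    spectral-decomposition i j = begin
      A i j                ≈⟨ ⊗-identityʳ A i j ⟨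
      (A ⊗ I) i j          ≈⟨ ⊗-congˡ A SᵀS≈I i j ⟨
      (A ⊗ (S ᵀ ⊗ S)) i j  ≈⟨ ⊗-assoc A (S ᵀ) S i j ⟨
      (A ⊗ S ᵀ ⊗ S) i j    ≈⟨ ⊗-congʳ S (λ i k → Av≈γv k i) i j ⟩
      spec γ i j           ∎

    A⊗spec : ∀ g → A ⊗ spec g ≈ᴹ spec (λ k → γ k * g k)
    A⊗spec g = ≈ᴹ-trans (⊗-congʳ (spec g) spectral-decomposition) (spec-⊗ γ g)

    spec⊗A : ∀ g → spec g ⊗ A ≈ᴹ spec (λ k → g k * γ k)
    spec⊗A g = ≈ᴹ-trans (⊗-congˡ (spec g) spectral-decomposition) (spec-⊗ g γ)

    -- It suffices that g k is a pseudo-inverse of the scalar γ k for each k.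
    spec-moorePenrose : ∀ g → (∀ k → γ k * g k * γ k ≈ γ k) →
                        (∀ k → g k * γ k * g k ≈ g k) → IsMoorePenroseInverse A (spec g)
    spec-moorePenrose g γgγ≈γ gγg≈g = record
      { AXA≈A  = ≈ᴹ-trans (⊗-congʳ A (A⊗spec g))
                   (≈ᴹ-trans (spec⊗A (λ k → γ k * g k))
                     (≈ᴹ-trans (spec-cong γgγ≈γ) (≈ᴹ-sym spectral-decomposition)))
      ; XAX≈X  = ≈ᴹ-trans (⊗-congʳ (spec g) (spec⊗A g))
                   (≈ᴹ-trans (spec-⊗ (λ k → g k * γ k) g) (spec-cong gγg≈g))
      ; AX-sym = symmetric (A⊗spec g)
      ; XA-sym = symmetric (spec⊗A g)
      }
      where
      symmetric : ∀ {B f} → B ≈ᴹ spec f → B ᵀ ≈ᴹ B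
      symmetric {f = f} B≈ i j =
        ≈-trans (B≈ j i) (≈-trans (spec-sym f i j) (≈-sym (B≈ i j)))

-- The spectrum of the Laplacian of a connected graph.  The number of vertices is
-- a variable here, and the index of the eigenvalue 0 is an arbitrary one called
-- last, so that sums over the vertices do not unfold.
module LaplacianSpectrum {c ℓ₁ ℓ₂ ℓ₃} (ℝ : RealField c ℓ₁ ℓ₂ ℓ₃) {n} (0<n : 0 ℕ.< n)
  (G : Graph n) (conn : Connected G)
  {γ : Vector (RealField.Carrier ℝ) n}
  {s : Fin n → Vector (RealField.Carrier ℝ) n}
  (eigenvector : ∀ k → Resistance.IsEigenvector ℝ (Resistance.laplacian ℝ G) (γ k) (s k))
  (normalized : ∀ k → RealField._≈_ ℝ (Resistance.⟨_,_⟩ ℝ (s k) (s k)) (RealField.1# ℝ))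
  (orthogonal : ∀ {k l} → k ≢ l →
                RealField._≈_ ℝ (Resistance.⟨_,_⟩ ℝ (s k) (s l)) (RealField.0# ℝ))
  (last : Fin n) (last≈0 : RealField._≈_ ℝ (γ last) (RealField.0# ℝ)) where
  open OrderedField ℝ
  open FiniteSums ℝ
  open MatrixAlgebra ℝ
  open LaplacianForm ℝ G
  open ResistanceDegree ℝ

  private
    L : Matrix n
    L = laplacian G
    u : Vector Carrier n
    u = s last

  n#0 : n · 1# # 0#
  n#0 = ℕ#0 n 0<n

  1/n : Carrier
  1/n = 1/ (n · 1#) [ n#0 ]

  ssᵀ≈I : s ⊗ s ᵀ ≈ᴹ I
  ssᵀ≈I i j with i ≟ᶠ j
  ... | yes ≡.refl = normalized i
  ... | no i≢j     = orthogonal i≢j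

  open OrthonormalBasis ℝ s ssᵀ≈I public

  Ls≈γs : ∀ k i → ∑[ j < n ] (L i j * s k j) ≈ γ k * s k i
  Ls≈γs k = IsEigenvector.Av≈μv (eigenvector k)

  energy-s : ∀ k → energy (s k) ≈ γ k
  energy-s k = begin
    ⟨ s k , (λ i → ∑[ j < n ] (L i j * s k j)) ⟩
      ≈⟨ sum-cong (λ i → ≈-trans (*-congˡ (Ls≈γs k i)) (x∙yz≈y∙xz (s k i) (γ k) (s k i))) ⟩
    ∑[ i < n ] (γ k * (s k i * s k i))
      ≈⟨ *-distribˡ-sum (γ k) (λ i → s k i * s k i) ⟨
    γ k * ⟨ s k , s k ⟩
      ≈⟨ *-congˡ (normalized k) ⟩
    γ k * 1#
      ≈⟨ *-identityʳ (γ k) ⟩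
    γ k ∎

  u-constant : ∀ i j → u i ≈ u j
  u-constant = kernel-constant conn u λ i →
    ≈-trans (Ls≈γs last i) (≈-trans (*-congʳ last≈0) (zeroˡ (u i)))

  u*u≈1/n : ∀ i → u i * u i ≈ 1/n
  u*u≈1/n i = x≈1/y n#0 (≈-trans
    (≈-sym (sum-const n (u i * u i)))
    (≈-trans (sum-cong λ j → *-cong (u-constant i j) (u-constant i j)) (normalized last)))

  -- Orthogonality to the constant vector u.
  sum-s≈0 : ∀ {k} → k ≢ last → ∑[ i < n ] s k i ≈ 0#
  sum-s≈0 {k} k≢last with IsEigenvector.nonzero (eigenvector last)
  ... | i , ui#0 = *-cancelˡ-#0 ui#0 (begin
    u i * (∑[ j < n ] s k j)
      ≈⟨ *-distribˡ-sum (u i) (s k) ⟩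
    ∑[ j < n ] (u i * s k j)
      ≈⟨ sum-cong (λ j → *-congʳ {x = s k j} (u-constant i j)) ⟩
    ⟨ u , s k ⟩
      ≈⟨ orthogonal (k≢last ∘ ≡.sym) ⟩
    0#
      ≈⟨ zeroʳ (u i) ⟨
    u i * 0# ∎)

  -- If v = s k has v i apart from 0, then the differences v i - v j add up to
  -- n v i, which is apart from 0, so v i is apart from some v j.
  γ#0 : ∀ {k} → k ≢ last → γ k # 0#
  γ#0 {k} k≢last with IsEigenvector.nonzero (eigenvector k)
  ... | i , vi#0 with sum#0⇒term#0 (λ j → s k i - s k j)
    (#-congʳ (≈-sym ∑≈nvᵢ) (x#0y#0→xy#0 n#0 vi#0))
    where
    v : Vector Carrier n
    v = s k
    ∑≈nvᵢ : ∑[ j < n ] (v i - v j) ≈ (n · 1#) * v i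
    ∑≈nvᵢ = ≈-trans (sum-diff (λ _ → v i) v)
      (≈-trans (+-cong (sum-const n (v i)) (-‿cong (sum-s≈0 k≢last))) (x-0≈x _))
  ...   | j , vi-vj#0 =
    #-congʳ (energy-s k) (energy#0 conn (s k) (x-y#0⇒x#y vi-vj#0))

  -- γ⁺ holds the inverses of the eigenvalues, and 0 for the eigenvalue 0.
  module PseudoInverse (γ⁺ : Vector Carrier n)
    (γγ⁺≈1 : ∀ {k} → k ≢ last → γ k * γ⁺ k ≈ 1#) (γ⁺-last≈0 : γ⁺ last ≈ 0#) where

    γγ⁺γ≈γ : ∀ k → γ k * γ⁺ k * γ k ≈ γ k
    γγ⁺γ≈γ k with k ≟ᶠ last
    ... | yes ≡.refl = ≈-trans (*-congˡ last≈0) (≈-trans (zeroʳ _) (≈-sym last≈0))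
    ... | no k≢last  = ≈-trans (*-congʳ (γγ⁺≈1 k≢last)) (*-identityˡ _)

    γ⁺γγ⁺≈γ⁺ : ∀ k → γ⁺ k * γ k * γ⁺ k ≈ γ⁺ k
    γ⁺γγ⁺≈γ⁺ k with k ≟ᶠ last
    ... | yes ≡.refl = ≈-trans (*-congˡ γ⁺-last≈0) (≈-trans (zeroʳ _) (≈-sym γ⁺-last≈0))
    ... | no k≢last  =
      ≈-trans (*-congʳ (≈-trans (*-comm _ _) (γγ⁺≈1 k≢last))) (*-identityˡ _)

    -- The eigenvalues of L L⁺ are 1, except for a 0 on the constant vectors.
    γγ⁺≈1-I : ∀ k → γ k * γ⁺ k ≈ 1# - I last k
    γγ⁺≈1-I k with k ≟ᶠ last
    ... | yes ≡.refl = ≈-trans (≈-trans (*-congʳ last≈0) (zeroˡ _))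
                         (≈-sym (x≈y⇒x∙y⁻¹≈ε (≈-sym (scalar-diag 1# last))))
    ... | no k≢last  = ≈-trans (γγ⁺≈1 k≢last)
                         (≈-sym (≈-trans (+-congˡ (-‿cong
                           (scalar-off-diag 1# (k≢last ∘ ≡.sym)))) (x-0≈x 1#)))

    -- The Moore-Penrose inverse of L.
    L⁺ : Matrix n
    L⁺ = spec γ⁺

    L⁺-sym : L⁺ ᵀ ≈ᴹ L⁺
    L⁺-sym = spec-sym γ⁺

    L⁺-moorePenrose : IsMoorePenroseInverse L L⁺
    L⁺-moorePenrose = spec-moorePenrose Ls≈γs γ⁺ γγ⁺γ≈γ γ⁺γγ⁺≈γ⁺

    L⁺-rowSum : ∀ i → ∑[ j < n ] L⁺ i j ≈ 0#
    L⁺-rowSum i = begin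
      ∑[ j < n ] L⁺ i j
        ≈⟨ ∑-comm (λ j k → γ⁺ k * s k i * s k j) ⟩
      ∑[ k < n ] (∑[ j < n ] (γ⁺ k * s k i * s k j))
        ≈⟨ sum-cong (λ k → *-distribˡ-sum (γ⁺ k * s k i) (s k)) ⟨
      ∑[ k < n ] (γ⁺ k * s k i * (∑[ j < n ] s k j))
        ≈⟨ sum-0 term≈0 ⟩
      0# ∎
      where
      term≈0 : ∀ k → γ⁺ k * s k i * (∑[ j < n ] s k j) ≈ 0#
      term≈0 k with k ≟ᶠ last
      ... | yes ≡.refl = ≈-trans (*-assoc _ _ _) (≈-trans (*-congʳ γ⁺-last≈0) (zeroˡ _))
      ... | no k≢last  = ≈-trans (*-congˡ (sum-s≈0 k≢last)) (zeroʳ _)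

    LL⁺-diagonal : ∀ i → (L ⊗ L⁺) i i ≈ 1# - 1/n
    LL⁺-diagonal i = begin
      (L ⊗ L⁺) i i
        ≈⟨ A⊗spec Ls≈γs γ⁺ i i ⟩
      ∑[ k < n ] (γ k * γ⁺ k * s k i * s k i)
        ≈⟨ sum-cong (λ k → ≈-trans (*-assoc _ _ _) (*-congʳ (γγ⁺≈1-I k))) ⟩
      ∑[ k < n ] ((1# - I last k) * (s k i * s k i))
        ≈⟨ sum-cong (λ k → ≈-trans ([y-z]x≈yx-zx _ 1# (I last k)) (+-congʳ (*-identityˡ _))) ⟩
      ∑[ k < n ] (s k i * s k i - I last k * (s k i * s k i))
        ≈⟨ sum-diff (λ k → s k i * s k i) (λ k → I last k * (s k i * s k i)) ⟩
      (s ᵀ ⊗ s) i i - ∑[ k < n ] (I last k * (s k i * s k i))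
        ≈⟨ +-cong (≈-trans (SᵀS≈I i i) (scalar-diag 1# i))
             (-‿cong (≈-trans (sum-I last (λ k → s k i * s k i)) (u*u≈1/n i))) ⟩
      1# - 1/n ∎

    -- The i-th diagonal entry of L L⁺, expanded with L = D - A.
    deg*L⁺ : ∀ i → (deg G i · 1#) * L⁺ i i ≈ ∑∈ (N G i) (L⁺ i) + 1# - 1/n
    deg*L⁺ i = begin
      (deg G i · 1#) * L⁺ i i
        ≈⟨ x-y≈z⇒x≈y+z (≈-trans (≈-sym (L-apply i (λ j → L⁺ j i))) (LL⁺-diagonal i)) ⟩
      ∑∈ (N G i) (λ j → L⁺ j i) + (1# - 1/n)
        ≈⟨ +-assoc _ _ _ ⟨
      ∑∈ (N G i) (λ j → L⁺ j i) + 1# - 1/n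
        ≈⟨ +-congʳ (+-congʳ (∑∈-cong (N G i) λ j → L⁺-sym i j)) ⟩
      ∑∈ (N G i) (L⁺ i) + 1# - 1/n ∎

    regular⇒diagonal : ResistanceRegular G → ∀ i j → L⁺ i i ≈ L⁺ j j
    regular⇒diagonal (L† , mp , regular) i j =
      *-cancelˡ-#0 n#0 (+-cancelʳ (trace L⁺) _ _ (begin
        (n · 1#) * L⁺ i i + trace L⁺  ≈⟨ degree i ⟩
        resistanceDegree L† i         ≈⟨ regular i j ⟩
        resistanceDegree L† j         ≈⟨ degree j ⟨
        (n · 1#) * L⁺ j j + trace L⁺  ∎))
      where
      degree : ∀ i → (n · 1#) * L⁺ i i + trace L⁺ ≈ resistanceDegree L† i
      degree i = ≈-trans (≈-sym (resistanceDegree-formula L⁺-rowSum i))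
        (resistanceDegree-cong (moorePenrose-unique L⁺-moorePenrose mp) i)

    diagonal⇒regular : (∀ i j → L⁺ i i ≈ L⁺ j j) → ResistanceRegular G
    diagonal⇒regular diagonal = L⁺ , L⁺-moorePenrose , λ i j → begin
      resistanceDegree L⁺ i         ≈⟨ resistanceDegree-formula L⁺-rowSum i ⟩
      (n · 1#) * L⁺ i i + trace L⁺  ≈⟨ +-congʳ (*-congˡ (diagonal i j)) ⟩
      (n · 1#) * L⁺ j j + trace L⁺  ≈⟨ resistanceDegree-formula L⁺-rowSum j ⟨
      resistanceDegree L⁺ j         ∎

-- The spectrum is specialised to n = suc m vertices, where the eigenvalue 0 has
-- the index fromℕ m.
theorem3p1 :
  ∀ {c ℓ₁ ℓ₂ ℓ₃} (ℝ : RealField c ℓ₁ ℓ₂ ℓ₃) → let open Resistance ℝ in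
  ∀ (m : ℕ) → let n = suc m in (2≤n : 2 ℕ.≤ n) →
  (G : Graph n) (conn : Connected G)
  (γ : Vector Carrier n) (s : Fin n → Vector Carrier n) →
  IsSpectralBasis (laplacian G) γ s →
  Σ[ γ#0 ∈ (∀ (k : Fin m) → γ (inject₁ k) # 0#) ]
    (ResistanceRegular G ⇔
      (let
         quantity : Fin n → Carrier
         quantity i =
           1/ (deg G i · 1#) [ ℕ#0 (deg G i) (connected⇒0<deg 2≤n G conn i) ]
           * ( ∑[ j ∈ N G i ] (∑[ k < m ] (1/ γ (inject₁ k) [ γ#0 k ]
                                           * s (inject₁ k) i * s (inject₁ k) j))
             + 1# - 1/ (n · 1#) [ ℕ#0 n (s≤s z≤n) ])
       in ∀ i j → quantity i ≈ quantity j))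
theorem3p1 ℝ m 2≤n G conn γ s basis = γ#0 , mk⇔
  (λ regular i j → ≈-trans (quantity≈L⁺ i)
    (≈-trans (regular⇒diagonal regular i j) (≈-sym (quantity≈L⁺ j))))
  (λ equal → diagonal⇒regular λ i j →
    ≈-trans (≈-sym (quantity≈L⁺ i)) (≈-trans (equal i j) (quantity≈L⁺ j)))
  where
  open OrderedField ℝ
  open FiniteSums ℝ
  open MatrixAlgebra ℝ
  open IsSpectralBasis basis
  module Spectrum = LaplacianSpectrum ℝ (s≤s z≤n) G conn
    eigenvector normalized orthogonal (fromℕ m) last≈0

  γ#0 : ∀ k → γ (inject₁ k) # 0#
  γ#0 k = Spectrum.γ#0 (fromℕ≢inject₁ ∘ ≡.sym)

  γ⁻¹ : Vector Carrier m
  γ⁻¹ k = 1/ γ (inject₁ k) [ γ#0 k ]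

  γ⁺ : Vector Carrier (suc m)
  γ⁺ = snoc γ⁻¹ 0#

  γγ⁺≈1 : ∀ {k} → k ≢ fromℕ m → γ k * γ⁺ k ≈ 1#
  γγ⁺≈1 = ≢last-elim (λ k → γ k * γ⁺ k ≈ 1#) λ k → ≈-trans (*-comm _ _)
    (≈-trans (*-congʳ (snoc-inject₁ γ⁻¹ 0# k)) (1/-inverseˡ (γ#0 k)))

  open Spectrum.PseudoInverse γ⁺ γγ⁺≈1 (snoc-fromℕ γ⁻¹ 0#)

  -- L⁺ without the term of the last index, which vanishes.
  X : Matrix (suc m)
  X i j = ∑[ k < m ] (γ⁻¹ k * s (inject₁ k) i * s (inject₁ k) j)

  L⁺≈X : L⁺ ≈ᴹ X
  L⁺≈X i j = sum-drop-last (λ k → γ⁺ k * s k i * s k j)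
    (λ k → γ⁻¹ k * s (inject₁ k) i * s (inject₁ k) j)
    (λ k → *-congʳ (*-congʳ (snoc-inject₁ γ⁻¹ 0# k)))
    (≈-trans (*-assoc _ _ _) (≈-trans (*-congʳ (snoc-fromℕ γ⁻¹ 0#)) (zeroˡ _)))

  d⁻¹ : Fin (suc m) → Carrier
  d⁻¹ i = 1/ (deg G i · 1#) [ ℕ#0 (deg G i) (connected⇒0<deg 2≤n G conn i) ]

  quantity≈L⁺ : ∀ i → d⁻¹ i * (∑∈ (N G i) (X i) + 1# - Spectrum.1/n) ≈ L⁺ i i
  quantity≈L⁺ i = begin
    d⁻¹ i * (∑∈ (N G i) (X i) + 1# - Spectrum.1/n)
      ≈⟨ *-congˡ (+-congʳ (+-congʳ (∑∈-cong (N G i) (L⁺≈X i)))) ⟨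
    d⁻¹ i * (∑∈ (N G i) (L⁺ i) + 1# - Spectrum.1/n)
      ≈⟨ *-congˡ (deg*L⁺ i) ⟨
    d⁻¹ i * ((deg G i · 1#) * L⁺ i i)
      ≈⟨ 1/x*[x*y]≈y _ (L⁺ i i) ⟩
    L⁺ i i ∎
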